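{- For every permutation $w\in S_n$, $\mathsf{rajcode}(w)=\mathsf{rajcode}(RD(w))$.
   Context: For $w\in S_n$, $\mathsf{Inv}(w)=\{(i,j):i<j,\ w(i)>w(j)\}$ and the Rothe diagram is $RD(w)=\{(r,w(r')):(r,r')\in\mathsf{Inv}(w)\}$. Let $\mathrm{LIS}^w(q)$ be the length of the longest increasing subsequence of the one-line notation of $w$ starting with $q$. $\mathsf{rajcode}(w)$ is the weak composition with $r$-th entry $n+1-r-\mathrm{LIS}^w(w(r))$ for $r\in[n]$ and $0$ for $r>n$. A diagram is a finite subset of $\mathbb{Z}_{>0}\times\mathbb{Z}_{>0}$; $(r,c)$ is in row $r$ (row 1 on top), column $c$. The snow diagram $\mathsf{snow}(D)$: iterate through the rows of $D$ from bottom to top; in row $r$, find the rightmost cell $(r,c)\in D$ such that column $c$ contains no dark cloud yet; if it exists, label it a dark cloud and add a snowflake cell at $(r',c)$ for each $r'<r$ with $(r',c)\notin D$. $\mathsf{rajcode}(D)$ is the weak composition whose $i$-th entry is the number of cells (original cells plus snowflakes) in row $i$ of $\mathsf{snow}(D)$. -}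

module Defs where

open import Data.Fin.Base using (Fin; toℕ; fromℕ<)
import Data.Fin.Properties as Fin
open import Data.Fin.Permutation using (Permutation′; _⟨$⟩ʳ_)
open import Data.List.Base using (List; []; _∷_; _++_; map; filter; foldl; head; length; concatMap; cartesianProduct; deduplicate; downFrom; tabulate; allFin)
open import Data.List.Extrema.Nat using (max; xs≤max; argmax-all)
import Data.List.Membership.DecPropositional as DecMembership
open import Data.List.Properties using (filter-none)
open import Data.List.Relation.Unary.All as All using (All; []; _∷_)
import Data.List.Relation.Unary.All.Properties as All
open import Data.List.Relation.Unary.AllPairs using (AllPairs; allPairs?)
open import Data.Maybe.Base using (Maybe; just; nothing)
import Data.Maybe.Properties as Maybe
open import Data.Nat.Base using (ℕ; suc; _+_; _∸_; _≤_; _<_; NonZero; s≤s; z≤n)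
open import Data.Nat.Properties using (_≟_; _<?_; <-≤-trans; <-irrefl)
open import Data.Product.Base using (_×_; _,_; proj₁; proj₂; ∃-syntax)
import Data.Product.Properties as Product
open import Function.Base using (_∘_; id)
open import Relation.Binary.Definitions using (DecidableEquality)
open import Relation.Binary.PropositionalEquality.Core using (_≡_; refl; cong)
open import Relation.Nullary.Decidable.Core using (yes; no; _×-dec_)
open import Relation.Nullary.Negation.Core using (contradiction)
open import Relation.Unary using (Decidable)

------------------------------------------------------------------------
-- Weak compositions: entries α₁, α₂, α₃, …, almost all of them zero.

record WeakComposition : Set where
  field
    entry  : (r : ℕ) → .{{NonZero r}} → ℕ
    finite : ∃[ N ] (∀ r .{{_ : NonZero r}} → N < r → entry r ≡ 0)

open WeakComposition public

infix 4 _≈_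

_≈_ : WeakComposition → WeakComposition → Set
α ≈ β = ∀ r .{{_ : NonZero r}} → entry α r ≡ entry β r

------------------------------------------------------------------------
-- Permutations.  Fin n is 0-based: i : Fin n stands for the position
-- suc (toℕ i) of [n], and likewise for values.

private
  variable
    n : ℕ

position : Fin n → ℕ
position i = suc (toℕ i)

value : Permutation′ n → Fin n → ℕ
value w i = suc (toℕ (w ⟨$⟩ʳ i))

oneLine : Permutation′ n → List ℕ
oneLine w = tabulate (value w)

subsequences : List ℕ → List (List ℕ)
subsequences []       = [] ∷ []
subsequences (x ∷ xs) = map (x ∷_) (subsequences xs) ++ subsequences xs

Increasing : List ℕ → Set
Increasing = AllPairs _<_

increasing? : Decidable Increasing
increasing? = allPairs? _<?_

increasingFrom : Permutation′ n → ℕ → List (List ℕ)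
increasingFrom w q =
  filter (λ s → Maybe.≡-dec _≟_ (head s) (just q) ×-dec increasing? s)
         (subsequences (oneLine w))

LIS : Permutation′ n → ℕ → ℕ
LIS w q = max 0 (map length (increasingFrom w q))

-- The truncated subtraction is never actually truncated: an increasing
-- subsequence starting with w(r) uses only positions r, …, n.
rajcodeEntry : (w : Permutation′ n) (r : ℕ) → .{{NonZero r}} → ℕ
rajcodeEntry {n} w (suc k) with k <? n
... | yes k<n = n + 1 ∸ suc k ∸ LIS w (value w (fromℕ< k<n))
... | no  _   = 0

rajcodeEntry-finite : (w : Permutation′ n) (r : ℕ) .{{_ : NonZero r}} →
                      n < r → rajcodeEntry w r ≡ 0
rajcodeEntry-finite {n} w (suc k) n<r with k <? n
... | yes k<n = contradiction (<-≤-trans n<r k<n) (<-irrefl refl)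
... | no  _   = refl

rajcodeᴾ : Permutation′ n → WeakComposition
rajcodeᴾ {n} w = record
  { entry  = rajcodeEntry w
  ; finite = n , rajcodeEntry-finite w
  }

Inv : Permutation′ n → List (Fin n × Fin n)
Inv {n} w =
  filter (λ (i , j) → (i Fin.<? j) ×-dec ((w ⟨$⟩ʳ j) Fin.<? (w ⟨$⟩ʳ i)))
         (cartesianProduct (allFin n) (allFin n))

------------------------------------------------------------------------
-- Diagrams.  Cells are pairs (row , column).  The list stands for the
-- set of its members: order and repetitions are irrelevant.

Cell : Set
Cell = ℕ × ℕ

infix 4 _≟ᶜ_

_≟ᶜ_ : DecidableEquality Cell
_≟ᶜ_ = Product.≡-dec _≟_ _≟_

open DecMembership _≟ᶜ_ using () renaming (_∉?_ to _∉ᶜ?_)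
open DecMembership _≟_ using (_∉?_)

Positive : Cell → Set
Positive (r , c) = 1 ≤ r × 1 ≤ c

record Diagram : Set where
  field
    cells    : List Cell
    positive : All Positive cells

open Diagram public

RD : Permutation′ n → Diagram
RD w = record
  { cells    = map (λ (r , r′) → position r , value w r′) (Inv w)
  ; positive = All.map⁺ (All.universal (λ _ → s≤s z≤n , s≤s z≤n) (Inv w))
  }

lastRow : List Cell → ℕ
lastRow cs = max 0 (map proj₁ cs)

row : ℕ → List Cell → List Cell
row r = filter (λ (r′ , _) → r′ ≟ r)

rightmost : List ℕ → Maybe ℕ
rightmost []       = nothing
rightmost (c ∷ cs) = just (max c cs)

-- Columns of the cells in row r of D whose column has no dark cloud yet.
candidates : List Cell → ℕ → List Cell → List ℕ
candidates D r clouds =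
  filter (λ c → c ∉? map proj₂ clouds) (map proj₂ (row r D))

addCloud : List Cell → List Cell → ℕ → List Cell
addCloud D clouds r with rightmost (candidates D r clouds)
... | just c  = (r , c) ∷ clouds
... | nothing = clouds

-- The rows are visited in the order lastRow D, …, 2, 1.
darkClouds : List Cell → List Cell
darkClouds D = foldl (addCloud D) [] (map suc (downFrom (lastRow D)))

snowflakes : List Cell → Cell → List Cell
snowflakes D (r , c) =
  filter (_∉ᶜ? D) (map (λ k → suc k , c) (downFrom (r ∸ 1)))

module _ (D : List Cell) (pos : All Positive D) where

  private
    PositiveColumn : Cell → Set
    PositiveColumn (_ , c) = 1 ≤ c

    candidates-positive : ∀ r clouds → All (1 ≤_) (candidates D r clouds)
    candidates-positive r clouds =
      All.filter⁺ _ (All.map⁺ (All.filter⁺ _ (All.map proj₂ pos)))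

    addCloud-positive : ∀ clouds r → All PositiveColumn clouds →
                        All PositiveColumn (addCloud D clouds r)
    addCloud-positive clouds r ps
      with candidates D r clouds | candidates-positive r clouds
    ... | []    | _      = ps
    ... | _ ∷ _ | q ∷ qs = argmax-all id q qs ∷ ps

    foldl-positive : ∀ clouds rs → All PositiveColumn clouds →
                     All PositiveColumn (foldl (addCloud D) clouds rs)
    foldl-positive clouds []       ps = ps
    foldl-positive clouds (r ∷ rs) ps =
      foldl-positive (addCloud D clouds r) rs (addCloud-positive clouds r ps)

    snowflakes-positive : ∀ cell → PositiveColumn cell →
                          All Positive (snowflakes D cell)
    snowflakes-positive (r , _) 1≤c =
      All.filter⁺ _ (All.map⁺ (All.universal (λ _ → s≤s z≤n , 1≤c) (downFrom (r ∸ 1))))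

  snow-positive : All Positive (D ++ concatMap (snowflakes D) (darkClouds D))
  snow-positive = All.++⁺ pos
    (All.concat⁺ (All.map⁺ (All.map (λ {cell} → snowflakes-positive cell)
      (foldl-positive [] (map suc (downFrom (lastRow D))) []))))

snow : Diagram → Diagram
snow D = record
  { cells    = cells D ++ concatMap (snowflakes (cells D)) (darkClouds (cells D))
  ; positive = snow-positive (cells D) (positive D)
  }

rowSize : List Cell → ℕ → ℕ
rowSize cs r = length (deduplicate _≟ᶜ_ (row r cs))

rowSize-finite : ∀ cs r → lastRow cs < r → rowSize cs r ≡ 0
rowSize-finite cs r last<r =
  cong (length ∘ deduplicate _≟ᶜ_) (filter-none (λ (r′ , _) → r′ ≟ r)
    (All.map (λ { r′≤last refl → <-irrefl refl (<-≤-trans last<r r′≤last) })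
             (All.map⁻ (xs≤max 0 (map proj₁ cs)))))

rajcodeᴰ : Diagram → WeakComposition
rajcodeᴰ D = record
  { entry  = λ r → rowSize (cells (snow D)) r
  ; finite = lastRow (cells (snow D)) , λ r → rowSize-finite (cells (snow D)) r
  }

{-# OPTIONS --safe #-}

-- Read the rows from bottom to top and call a value w(r′), r′ > r, free if its
-- column has no dark cloud in the rows below r.  Row r puts its dark cloud in
-- the column of the largest free value below w(r), and then w(r) becomes free:
-- this is Schensted row insertion.  Hence the number of free values above x is
-- the length of a longest increasing subsequence of w(r+1), …, w(n) with all
-- values above x.  For x = w(r), the free values above x are exactly the
-- columns w(r′), r′ > r, that are missing from row r of the snow diagram.
module Submission where

open import Data.Fin.Base as Fin using (Fin; toℕ; fromℕ<)
open import Data.Fin.Permutation using (Permutation′; _⟨$⟩ʳ_)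
import Data.Fin.Properties as Fin
open import Data.List.Base using (List; []; _∷_; _++_; map; filter; foldl; head; length; concatMap; cartesianProduct; deduplicate; downFrom; tabulate; allFin)
open import Data.List.Extrema.Nat using (max≤v⁺; v≤max⁺; ⊥≤max; xs≤max; argmax-all)
import Data.List.Membership.DecPropositional as DecMembership
open import Data.List.Membership.Propositional using (_∈_; _∉_; find; lose)
open import Data.List.Membership.Propositional.Properties
open import Data.List.Properties using (length-++; length-map; length-tabulate; filter-accept; filter-reject; filter-none; filter-≐)
open import Data.List.Relation.Binary.Subset.Propositional using (_⊆_)
open import Data.List.Relation.Unary.All as All using (All; []; _∷_)
import Data.List.Relation.Unary.All.Properties as All
open import Data.List.Relation.Unary.AllPairs using ([]; _∷_)
open import Data.List.Relation.Unary.Any using (here; there)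
open import Data.List.Relation.Unary.Unique.Propositional using (Unique)
import Data.List.Relation.Unary.Unique.Propositional.Properties as Unique
open import Data.Maybe.Base using (just)
import Data.Maybe.Properties as Maybe
open import Data.Nat.Base
open import Data.Nat.Properties
open import Data.Product.Base using (_×_; _,_; proj₁; proj₂; ∃-syntax)
open import Data.Sum.Base using (_⊎_; inj₁; inj₂)
open import Function.Base using (_∘_; id)
open import Function.Bundles using (_⇔_; mk⇔; Equivalence; Injection)
open import Function.Properties.Inverse using (↔⇒↣)
open import Relation.Binary.Definitions using (tri<; tri≈; tri>)
open import Relation.Binary.PropositionalEquality
open import Relation.Nullary.Decidable using (yes; no; _×-dec_; ¬?)
open import Relation.Nullary.Negation using (¬_; contradiction)
open import Relation.Unary using (Pred; Decidable)
open import Defs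

open DecMembership _≟_ using (_∈?_; _∉?_)
open DecMembership _≟ᶜ_ using () renaming (_∉?_ to _∉ᶜ?_)
open import Data.List.Relation.Unary.Unique.DecPropositional.Properties _≟ᶜ_ using (deduplicate-!)

open Equivalence using (to; from)

-- Counting in lists without repetitions

module _ {a} {A : Set a} where

  length-mono-⊆ : {xs ys : List A} → Unique xs → xs ⊆ ys → length xs ≤ length ys
  length-mono-⊆ {[]}     _          _     = z≤n
  length-mono-⊆ {x ∷ xs} (x∉ ∷ xs!) xs⊆ys with ∈-∃++ (xs⊆ys (here refl))
  ... | us , vs , refl = begin
    suc (length xs)             ≤⟨ s≤s (length-mono-⊆ xs! xs⊆us++vs) ⟩
    suc (length (us ++ vs))     ≡⟨ cong suc (length-++ us) ⟩
    suc (length us + length vs) ≡⟨ +-suc (length us) (length vs) ⟨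
    length us + suc (length vs) ≡⟨ length-++ us ⟨
    length (us ++ x ∷ vs)       ∎
    where
    open ≤-Reasoning
    xs⊆us++vs : xs ⊆ us ++ vs
    xs⊆us++vs y∈ with ∈-++⁻ us (xs⊆ys (there y∈))
    ... | inj₁ y∈us         = ∈-++⁺ˡ y∈us
    ... | inj₂ (here refl)  = contradiction refl (All.lookup x∉ y∈)
    ... | inj₂ (there y∈vs) = ∈-++⁺ʳ us y∈vs

  length-cong-⊆ : {xs ys : List A} → Unique xs → Unique ys → xs ⊆ ys → ys ⊆ xs →
                  length xs ≡ length ys
  length-cong-⊆ xs! ys! xs⊆ys ys⊆xs =
    ≤-antisym (length-mono-⊆ xs! xs⊆ys) (length-mono-⊆ ys! ys⊆xs)

  module _ {p} {P : Pred A p} (P? : Decidable P) where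

    length-filter-¬ : ∀ xs → length (filter (¬? ∘ P?) xs) + length (filter P? xs) ≡ length xs
    length-filter-¬ []       = refl
    length-filter-¬ (x ∷ xs) with P? x
    ... | yes _ = trans (+-suc _ _) (cong suc (length-filter-¬ xs))
    ... | no  _ = cong suc (length-filter-¬ xs)

-- Longest increasing subsequences

-- The length of a longest increasing subsequence with all terms above `x`. Recursing on the first
-- letter makes it comparable with the insertion of one row at a time.
lisAbove : ℕ → List ℕ → ℕ
lisAbove x []       = 0
lisAbove x (y ∷ ys) with x <? y
... | yes _ = lisAbove x ys ⊔ suc (lisAbove y ys)
... | no  _ = lisAbove x ys

-- Putting `x` in front of `t` encodes the bound, so that when `y` is taken the tail of the
-- hypothesis is already the hypothesis for the bound `y`.
lisAbove-upper : ∀ {x t} ys → t ∈ subsequences ys → Increasing (x ∷ t) →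
                 length t ≤ lisAbove x ys
lisAbove-upper [] (here refl) _ = z≤n
lisAbove-upper {x} (y ∷ ys) t∈ inc
  with x <? y | ∈-++⁻ (map (y ∷_) (subsequences ys)) t∈
... | yes _ | inj₂ t∈′ = ≤-trans (lisAbove-upper ys t∈′ inc) (m≤m⊔n _ _)
... | no  _ | inj₂ t∈′ = lisAbove-upper ys t∈′ inc
... | yes _ | inj₁ t∈′ with ∈-map⁻ (y ∷_) t∈′ | inc
...   | _ , u∈ , refl | _ ∷ inc′ = ≤-trans (s≤s (lisAbove-upper ys u∈ inc′)) (m≤n⊔m _ _)
lisAbove-upper {x} (y ∷ ys) t∈ inc | no x≮y | inj₁ t∈′ with ∈-map⁻ (y ∷_) t∈′ | inc
...   | _ , _ , refl | (x<y ∷ _) ∷ _ = contradiction x<y x≮y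

lisAbove-attained : ∀ x ys → ∃[ t ] (t ∈ subsequences ys × Increasing (x ∷ t) × length t ≡ lisAbove x ys)
lisAbove-attained x []       = [] , here refl , [] ∷ [] , refl
lisAbove-attained x (y ∷ ys) with x <? y | lisAbove-attained x ys
... | no  _   | t , t∈ , inc , eq = t , ∈-++⁺ʳ _ t∈ , inc , eq
... | yes x<y | t , t∈ , inc , eq with lisAbove-attained y ys
...   | u , u∈ , incᵤ@(y<u ∷ _) , eqᵤ
        with ≤-total (suc (lisAbove y ys)) (lisAbove x ys)
...     | inj₁ s≤ = t , ∈-++⁺ʳ _ t∈ , inc , trans eq (sym (m≥n⇒m⊔n≡m s≤))
...     | inj₂ ≤s = y ∷ u , ∈-++⁺ˡ (∈-map⁺ (y ∷_) u∈)
                  , (x<y ∷ All.map (<-trans x<y) y<u) ∷ incᵤ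
                  , trans (cong suc eqᵤ) (sym (m≤n⇒m⊔n≡n ≤s))

∈-subsequence : ∀ {y s} ys → s ∈ subsequences ys → y ∈ s → y ∈ ys
∈-subsequence []       (here refl) ()
∈-subsequence (z ∷ ys) s∈ y∈ with ∈-++⁻ (map (z ∷_) (subsequences ys)) s∈
... | inj₂ s∈′ = there (∈-subsequence ys s∈′ y∈)
... | inj₁ s∈′ with ∈-map⁻ (z ∷_) s∈′ | y∈
...   | _ , _  , refl | here refl = here refl
...   | _ , u∈ , refl | there y∈′ = there (∈-subsequence ys u∈ y∈′)

∈-subsequences-++⁺ : ∀ {s ys} xs → s ∈ subsequences ys → s ∈ subsequences (xs ++ ys)
∈-subsequences-++⁺ []       s∈ = s∈
∈-subsequences-++⁺ (x ∷ xs) s∈ = ∈-++⁺ʳ _ (∈-subsequences-++⁺ xs s∈)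

-- The only `y` is the displayed one, so a subsequence starting with `y` skips all of `xs` and
-- continues inside `ys`.
∈-subsequences-from : ∀ {y t ys} xs → Unique (xs ++ y ∷ ys) →
                      y ∷ t ∈ subsequences (xs ++ y ∷ ys) → t ∈ subsequences ys
∈-subsequences-from {y} {ys = ys} [] (y∉ ∷ _) s∈
  with ∈-++⁻ (map (y ∷_) (subsequences ys)) s∈
... | inj₂ s∈′ = contradiction refl (All.lookup y∉ (∈-subsequence ys s∈′ (here refl)))
... | inj₁ s∈′ with ∈-map⁻ (y ∷_) s∈′
...   | _ , t∈ , refl = t∈
∈-subsequences-from {y} {ys = ys} (x ∷ xs) (x∉ ∷ xs!) s∈
  with ∈-++⁻ (map (x ∷_) (subsequences (xs ++ y ∷ ys))) s∈
... | inj₂ s∈′ = ∈-subsequences-from xs xs! s∈′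
... | inj₁ s∈′ with ∈-map⁻ (x ∷_) s∈′
...   | _ , _ , refl = contradiction refl (All.lookup x∉ (∈-++⁺ʳ xs (here refl)))

-- Passes from the maximum over an enumeration to the recursion. The extra one counts `y` itself.
LIS≡1+lisAbove : ∀ {n} (w : Permutation′ n) xs {y ys} →
                 oneLine w ≡ xs ++ y ∷ ys → Unique (oneLine w) →
                 LIS w y ≡ suc (lisAbove y ys)
LIS≡1+lisAbove w xs {y} {ys} eq w! = ≤-antisym
  (max≤v⁺ z≤n (All.map⁺ (All.tabulate (upper _))))
  (v≤max⁺ 0 _ (inj₂ lower))
  where
  upper : ∀ s → s ∈ increasingFrom w y → length s ≤ suc (lisAbove y ys)
  upper s s∈ with ∈-filter⁻ (λ s → Maybe.≡-dec _≟_ (head s) (just y) ×-dec increasing? s) {xs = subsequences (oneLine w)} s∈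
  upper []      _ | _   , ()   , _
  upper (_ ∷ t) _ | s∈′ , refl , inc = s≤s (lisAbove-upper ys
    (∈-subsequences-from xs (subst Unique eq w!) (subst (λ v → y ∷ t ∈ subsequences v) eq s∈′)) inc)

  lower = let t , t∈ , inc , len = lisAbove-attained y ys in
    lose (∈-map⁺ length (∈-filter⁺ _
           (subst (λ v → y ∷ t ∈ subsequences v) (sym eq)
             (∈-subsequences-++⁺ xs (∈-++⁺ˡ (∈-map⁺ (y ∷_) t∈))))
           (refl , inc)))
         (≤-reflexive (cong suc (sym len)))

-- Dark clouds

module _ {D : List Cell} {r : ℕ} {clouds : List Cell} where

  ∈-candidates⁺ : ∀ {c} → (r , c) ∈ D → c ∉ map proj₂ clouds → c ∈ candidates D r clouds
  ∈-candidates⁺ p∈ c∉ = ∈-filter⁺ _ (∈-map⁺ proj₂ (∈-filter⁺ _ p∈ refl)) c∉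

  ∈-candidates⁻ : ∀ {c} → c ∈ candidates D r clouds → (r , c) ∈ D × c ∉ map proj₂ clouds
  ∈-candidates⁻ c∈ with ∈-filter⁻ (_∉? map proj₂ clouds) {xs = map proj₂ (row r D)} c∈
  ... | c∈′ , c∉ with ∈-map⁻ proj₂ c∈′
  ...   | _ , p∈ , refl with ∈-filter⁻ (λ (r′ , _) → r′ ≟ r) {xs = D} p∈
  ...     | p∈′ , refl = p∈′ , c∉

-- The two outcomes of a row in the form used later: the new cloud is the rightmost cell in a
-- cloudless column, or no cell of the row lies in a cloudless column.
data AddCloudView (D clouds : List Cell) (r : ℕ) : List Cell → Set where
  added : ∀ {m} → (r , m) ∈ D → m ∉ map proj₂ clouds →
          (∀ {c} → (r , c) ∈ D → c ∉ map proj₂ clouds → c ≤ m) →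
          AddCloudView D clouds r ((r , m) ∷ clouds)
  none  : (∀ {c} → (r , c) ∈ D → ¬ c ∉ map proj₂ clouds) →
          AddCloudView D clouds r clouds

addCloud-view : ∀ D clouds r → AddCloudView D clouds r (addCloud D clouds r)
addCloud-view D clouds r
  -- Both membership lemmas are abstracted along with the list, so that they refer to the list being
  -- matched.
  with candidates D r clouds
     | (λ {c} → ∈-candidates⁺ {D} {r} {clouds} {c})
     | (λ {c} → ∈-candidates⁻ {D} {r} {clouds} {c})
... | []     | ⁺ | _ = none λ p∈ c∉ → contradiction (⁺ p∈ c∉) λ ()
... | c ∷ cs | ⁺ | ⁻ =
  -- `max c cs` is an `argmax` of `id` and so inherits any property shared by `c` and all of `cs`;
  -- here, being a candidate.
  let p∈ , c∉ = ⁻ (argmax-all id {P = _∈ c ∷ cs} (here refl) (All.tabulate there))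
  in added p∈ c∉ λ q∈ d∉ → All.lookup (⊥≤max c cs ∷ xs≤max c cs) (⁺ q∈ d∉)

-- The dark clouds found in the rows k + j, …, k + 1.
clouds : List Cell → ℕ → ℕ → List Cell
clouds D k zero    = []
clouds D k (suc j) = addCloud D (clouds D (suc k) j) (suc k)

module _ (D : List Cell) where

  ∈-clouds⇒∈ : ∀ {p} k j → p ∈ clouds D k j → p ∈ D × k < proj₁ p
  ∈-clouds⇒∈ k (suc j) p∈
    with addCloud D (clouds D (suc k) j) (suc k) | addCloud-view D (clouds D (suc k) j) (suc k)
  ∈-clouds⇒∈ k (suc j) (here refl) | _ | added q∈ _ _ = q∈ , ≤-refl
  ∈-clouds⇒∈ k (suc j) (there p∈)  | _ | added _ _ _ =
    let p∈D , k<p = ∈-clouds⇒∈ (suc k) j p∈ in p∈D , <⇒≤ k<p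
  ∈-clouds⇒∈ k (suc j) p∈          | _ | none _ =
    let p∈D , k<p = ∈-clouds⇒∈ (suc k) j p∈ in p∈D , <⇒≤ k<p

  clouds-step⁺ : ∀ {p} k j → p ∈ clouds D (suc k) j → p ∈ clouds D k (suc j)
  clouds-step⁺ k j p∈
    with addCloud D (clouds D (suc k) j) (suc k) | addCloud-view D (clouds D (suc k) j) (suc k)
  ... | _ | added _ _ _ = there p∈
  ... | _ | none _      = p∈

  clouds-step⁻ : ∀ {p} k j → p ∈ clouds D k (suc j) → suc k < proj₁ p → p ∈ clouds D (suc k) j
  clouds-step⁻ k j p∈ k<p
    with addCloud D (clouds D (suc k) j) (suc k) | addCloud-view D (clouds D (suc k) j) (suc k)
  clouds-step⁻ k j (here refl) k<p | _ | added _ _ _ = contradiction k<p (<-irrefl refl)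
  clouds-step⁻ k j (there p∈)  k<p | _ | added _ _ _ = p∈
  clouds-step⁻ k j p∈          k<p | _ | none _      = p∈

  -- Rows `k`, ..., 1 are visited later and each adds a cloud only in its own row, so below row `k`
  -- the final clouds are those of `clouds D k j`. Both directions lower `k` with `k + j` fixed.
  clouds-all⁺ : ∀ {p} k j → p ∈ clouds D k j → p ∈ clouds D 0 (k + j)
  clouds-all⁺ zero    j p∈ = p∈
  clouds-all⁺ {p} (suc k) j p∈ =
    subst (λ n → p ∈ clouds D 0 n) (+-suc k j) (clouds-all⁺ k (suc j) (clouds-step⁺ k j p∈))

  clouds-all⁻ : ∀ {p} k j → p ∈ clouds D 0 (k + j) → k < proj₁ p → p ∈ clouds D k j
  clouds-all⁻ zero    j p∈ _   = p∈
  clouds-all⁻ {p} (suc k) j p∈ k<p = clouds-step⁻ k j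
    (clouds-all⁻ k (suc j) (subst (λ n → p ∈ clouds D 0 n) (sym (+-suc k j)) p∈) (<⇒≤ k<p)) k<p

  -- The accumulator always has the form `clouds D k j`: visiting one more row lowers `k` and raises
  -- `j`.
  foldl-addCloud : ∀ k j → foldl (addCloud D) (clouds D k j) (map suc (downFrom k)) ≡ clouds D 0 (k + j)
  foldl-addCloud zero    j = refl
  foldl-addCloud (suc k) j = trans (foldl-addCloud k (suc j)) (cong (clouds D 0) (+-suc k j))

  clouds-empty : ∀ k j → (∀ {r c} → (r , c) ∈ D → r ≤ k) → clouds D k j ≡ []
  clouds-empty k j D≤k with clouds D k j | (λ {p} → ∈-clouds⇒∈ {p} k j)
  ... | []    | _ = refl
  ... | p ∷ _ | h = let p∈ , k<p = h (here refl) in contradiction (D≤k p∈) (<⇒≱ k<p)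

  -- `darkClouds` starts at the last occupied row. The rows from there down to `n` are empty and
  -- give no cloud, so the visit may as well start at `n`, which is later the length of the word.
  darkClouds≡clouds : ∀ n → (∀ {r c} → (r , c) ∈ D → r ≤ n) → darkClouds D ≡ clouds D 0 n
  darkClouds≡clouds n D≤n = begin
    visit []                     ≡⟨ cong visit (clouds-empty l (n ∸ l) ≤l) ⟨
    visit (clouds D l (n ∸ l))   ≡⟨ foldl-addCloud l (n ∸ l) ⟩
    clouds D 0 (l + (n ∸ l))     ≡⟨ cong (clouds D 0) (m+[n∸m]≡n l≤n) ⟩
    clouds D 0 n                 ∎
    where
    open ≡-Reasoning
    l = lastRow D
    visit : List Cell → List Cell
    visit cs = foldl (addCloud D) cs (map suc (downFrom l))
    ≤l : ∀ {r c} → (r , c) ∈ D → r ≤ l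
    ≤l p∈ = All.lookup (xs≤max 0 (map proj₁ D)) (∈-map⁺ proj₁ p∈)
    l≤n : l ≤ n
    l≤n = max≤v⁺ z≤n (All.map⁺ (All.tabulate D≤n))

-- Row insertion

-- The rows k + 1, k + 2, … of D are those of the Rothe diagram of a word whose
-- letters from position k + 1 on are the given list.
data Rothe (D : List Cell) : ℕ → List ℕ → Set where
  []  : ∀ {k} → (∀ {r c} → (r , c) ∈ D → r ≤ k) → Rothe D k []
  _∷_ : ∀ {k y ys} → (∀ {c} → (suc k , c) ∈ D ⇔ (c ∈ ys × c < y)) →
        Rothe D (suc k) ys → Rothe D k (y ∷ ys)

Rothe-++⁻ : ∀ {D ys} k xs → Rothe D k (xs ++ ys) → Rothe D (k + length xs) ys
Rothe-++⁻ {D} {ys} k [] R = subst (λ n → Rothe D n ys) (sym (+-identityʳ k)) R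
Rothe-++⁻ {D} {ys} k (x ∷ xs) (_ ∷ R) =
  subst (λ n → Rothe D n ys) (sym (+-suc k (length xs))) (Rothe-++⁻ (suc k) xs R)

cloudColumns : List Cell → ℕ → List ℕ → List ℕ
cloudColumns D k ys = map proj₂ (clouds D k (length ys))

-- Clouds lie on cells of `D`, whose columns are letters further right. If the letters are distinct,
-- the column of a letter is therefore still cloudless when its row is reached.
cloudColumns-⊆ : ∀ {D k ys} → Rothe D k ys → cloudColumns D k ys ⊆ ys
cloudColumns-⊆ ([] _) ()
cloudColumns-⊆ {D} {k} {y ∷ ys} (row⇔ ∷ R) c∈
  with addCloud D (clouds D (suc k) (length ys)) (suc k)
     | addCloud-view D (clouds D (suc k) (length ys)) (suc k)
cloudColumns-⊆ (row⇔ ∷ R) (here refl) | _ | added p∈ _ _ = there (proj₁ (to row⇔ p∈))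
cloudColumns-⊆ (row⇔ ∷ R) (there c∈)  | _ | added _ _ _  = there (cloudColumns-⊆ R c∈)
cloudColumns-⊆ (row⇔ ∷ R) c∈          | _ | none _       = there (cloudColumns-⊆ R c∈)

freeAbove? : ∀ (cs : List ℕ) x → Decidable (λ c → x < c × c ∉ cs)
freeAbove? cs x c = (x <? c) ×-dec (c ∉? cs)

freeAbove : List ℕ → ℕ → List ℕ → List ℕ
freeAbove cs x = filter (freeAbove? cs x)

module _ {cs : List ℕ} {x : ℕ} where

  ∈-freeAbove⁺ : ∀ {c ys} → c ∈ ys → x < c → c ∉ cs → c ∈ freeAbove cs x ys
  ∈-freeAbove⁺ c∈ x<c c∉ = ∈-filter⁺ (freeAbove? cs x) c∈ (x<c , c∉)

  ∈-freeAbove⁻ : ∀ {c} ys → c ∈ freeAbove cs x ys → c ∈ ys × x < c × c ∉ cs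
  ∈-freeAbove⁻ ys = ∈-filter⁻ (freeAbove? cs x) {xs = ys}

  freeAbove-! : ∀ {ys} → Unique ys → Unique (freeAbove cs x ys)
  freeAbove-! = Unique.filter⁺ (freeAbove? cs x)

  freeAbove-antitone : ∀ {y} ys → x < y → freeAbove cs y ys ⊆ freeAbove cs x ys
  freeAbove-antitone ys x<y c∈ =
    let c∈ys , y<c , c∉ = ∈-filter⁻ (freeAbove? cs _) {xs = ys} c∈
    in ∈-freeAbove⁺ c∈ys (<-trans x<y y<c) c∉

  -- `m` is not among the letters above `x`, so its cloud changes nothing there.
  freeAbove-cloud-≮ : ∀ {m} ys → ¬ x < m → freeAbove (m ∷ cs) x ys ≡ freeAbove cs x ys
  freeAbove-cloud-≮ ys x≮m = filter-≐ (freeAbove? _ x) (freeAbove? cs x)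
    ( (λ (x<c , c∉) → x<c , c∉ ∘ there)
    , (λ (x<c , c∉) → x<c , λ { (here refl) → x≮m x<c ; (there c∈) → c∉ c∈ })) ys

  -- `m` was free and occurs once in `ys`, so the new cloud removes exactly one letter from the
  -- count.
  length-freeAbove-cloud-< : ∀ {m ys} → Unique ys → m ∈ ys → m ∉ cs → x < m →
                             length (freeAbove cs x ys) ≡ suc (length (freeAbove (m ∷ cs) x ys))
  length-freeAbove-cloud-< {m} {ys} ys! m∈ m∉ x<m =
    length-cong-⊆ (freeAbove-! ys!) (All.tabulate m≢ ∷ Unique.filter⁺ _ ys!) fwd bwd
    where
    split : ∀ {c} → c ∈ freeAbove (m ∷ cs) x ys → c ∈ ys × x < c × c ∉ m ∷ cs
    split = ∈-filter⁻ (freeAbove? (m ∷ cs) x) {xs = ys}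

    m≢ : ∀ {c} → c ∈ freeAbove (m ∷ cs) x ys → m ≢ c
    m≢ c∈ refl = proj₂ (proj₂ (split c∈)) (here refl)

    fwd : freeAbove cs x ys ⊆ m ∷ freeAbove (m ∷ cs) x ys
    fwd {c} c∈ with c ≟ m | ∈-freeAbove⁻ ys c∈
    ... | yes c≡m | _                = here c≡m
    ... | no  c≢m | c∈ys , x<c , c∉ = there (∈-filter⁺ (freeAbove? (m ∷ cs) x) c∈ys
      (x<c , λ { (here c≡m) → c≢m c≡m ; (there c∈cs) → c∉ c∈cs }))

    bwd : m ∷ freeAbove (m ∷ cs) x ys ⊆ freeAbove cs x ys
    bwd (here refl) = ∈-freeAbove⁺ m∈ x<m m∉
    bwd (there c∈)  = let c∈ys , x<c , c∉ = split c∈ in ∈-freeAbove⁺ c∈ys x<c (c∉ ∘ there)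

  -- The only free letters that the bounds `x` and `y` could tell apart lie between them or equal
  -- `y`; the gap hypothesis excludes the former, distinctness the latter.
  length-freeAbove-gap : ∀ {y ys} → Unique (y ∷ ys) → x < y →
                         (∀ {c} → c ∈ ys → c < y → c ∉ cs → ¬ x < c) →
                         length (freeAbove cs x ys) ≡ length (freeAbove cs y ys)
  length-freeAbove-gap {y} {ys} (y∉ ∷ ys!) x<y gap =
    length-cong-⊆ (freeAbove-! ys!) (Unique.filter⁺ _ ys!) fwd (freeAbove-antitone ys x<y)
    where
    fwd : freeAbove cs x ys ⊆ freeAbove cs y ys
    fwd {c} c∈ with ∈-freeAbove⁻ ys c∈ | <-cmp c y
    ... | c∈ys , x<c , c∉ | tri< c<y _ _  = contradiction x<c (gap c∈ys c<y c∉)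
    ... | c∈ys , x<c , c∉ | tri≈ _ refl _ = contradiction refl (All.lookup y∉ c∈ys)
    ... | c∈ys , x<c , c∉ | tri> _ _ y<c  = ∈-filter⁺ (freeAbove? cs y) c∈ys (y<c , c∉)

-- Induction from the last row up, for all `x` at once because `lisAbove` also asks for the bound
-- `y`. If `y ≤ x`, nothing above `x` changes. If the cloud `m` has `x < m < y`, then `y` replaces
-- `m` and the count stays. Otherwise no free letter lies between `x` and `y`, and the count grows
-- by one.
length-freeAbove : ∀ {D k ys} → Rothe D k ys → Unique ys → ∀ x →
                   length (freeAbove (cloudColumns D k ys) x ys) ≡ lisAbove x ys
length-freeAbove ([] _) _ x = refl
length-freeAbove {D} {k} {y ∷ ys} (row⇔ ∷ R) y∷ys!@(y∉ ∷ ys!) x =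
  step (addCloud-view D (clouds D (suc k) (length ys)) (suc k))
  where
  open ≡-Reasoning
  cs = cloudColumns D (suc k) ys

  IH : ∀ x → length (freeAbove cs x ys) ≡ lisAbove x ys
  IH = length-freeAbove R ys!

  y∉cs : y ∉ cs
  y∉cs y∈ = All.lookup y∉ (cloudColumns-⊆ R y∈) refl

  no-bump : x < y → (∀ {c} → c ∈ ys → c < y → c ∉ cs → ¬ x < c) →
            suc (length (freeAbove cs x ys)) ≡ lisAbove x ys ⊔ suc (lisAbove y ys)
  no-bump x<y gap = begin
    suc (length (freeAbove cs x ys))    ≡⟨ cong suc x≡y ⟩
    suc (length (freeAbove cs y ys))    ≡⟨ cong suc (IH y) ⟩
    -- `lisAbove x ys` and `lisAbove y ys` agree, both counting the same free letters, so the
    -- maximum is attained by taking `y`.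
    suc (lisAbove y ys)                 ≡⟨ m≤n⇒m⊔n≡n (m≤n⇒m≤1+n (≤-reflexive (trans (sym (IH x)) (trans x≡y (IH y))))) ⟨
    lisAbove x ys ⊔ suc (lisAbove y ys) ∎
    where x≡y = length-freeAbove-gap y∷ys! x<y gap

  bump : ∀ {m} → m ∈ ys → m ∉ cs → x < m → m < y →
         suc (length (freeAbove (m ∷ cs) x ys)) ≡ lisAbove x ys ⊔ suc (lisAbove y ys)
  bump {m} m∈ m∉ x<m m<y = begin
    suc (length (freeAbove (m ∷ cs) x ys)) ≡⟨ length-freeAbove-cloud-< ys! m∈ m∉ x<m ⟨
    length (freeAbove cs x ys)             ≡⟨ IH x ⟩
    lisAbove x ys                          ≡⟨ m≥n⇒m⊔n≡m lis-y<lis-x ⟨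
    lisAbove x ys ⊔ suc (lisAbove y ys)    ∎
    where
    -- `m` is counted above `x` but not above `y`, so skipping `y` loses nothing.
    lis-y<lis-x : lisAbove y ys < lisAbove x ys
    lis-y<lis-x = subst₂ _≤_
      (cong suc (trans (cong length (freeAbove-cloud-≮ ys (<-asym m<y))) (IH y)))
      (trans (sym (length-freeAbove-cloud-< ys! m∈ m∉ x<m)) (IH x))
      (s≤s (length-mono-⊆ (freeAbove-! ys!) (freeAbove-antitone ys (<-trans x<m m<y))))

  accept : ∀ {m} → x < y → m < y →
           length (freeAbove (m ∷ cs) x (y ∷ ys)) ≡ suc (length (freeAbove (m ∷ cs) x ys))
  accept x<y m<y = cong length (filter-accept (freeAbove? _ x)
    (x<y , λ { (here refl) → <-irrefl refl m<y ; (there y∈) → y∉cs y∈ }))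

  step : ∀ {cl} → AddCloudView D (clouds D (suc k) (length ys)) (suc k) cl →
         length (freeAbove (map proj₂ cl) x (y ∷ ys)) ≡ lisAbove x (y ∷ ys)
  step v with x <? y
  step (none _) | no x≮y =
    trans (cong length (filter-reject (freeAbove? cs x) (x≮y ∘ proj₁))) (IH x)
  step (added {m} m∈ m∉ ≤m) | no x≮y = begin
    length (freeAbove (m ∷ cs) x (y ∷ ys)) ≡⟨ cong length (filter-reject (freeAbove? (m ∷ cs) x) (x≮y ∘ proj₁)) ⟩
    -- Here `m < y` and `y ≤ x`, so the new cloud lies outside the range above `x`.
    length (freeAbove (m ∷ cs) x ys)       ≡⟨ cong length (freeAbove-cloud-≮ ys λ x<m → x≮y (<-trans x<m (proj₂ (to row⇔ m∈)))) ⟩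
    length (freeAbove cs x ys)             ≡⟨ IH x ⟩
    lisAbove x ys                          ∎
  step (none all∈) | yes x<y = trans
    (cong length (filter-accept (freeAbove? cs x) (x<y , y∉cs)))
    -- A row without a candidate means that there is no free letter below `y` at all.
    (no-bump x<y λ c∈ c<y c∉ _ → all∈ (from row⇔ (c∈ , c<y)) c∉)
  step (added {m} m∈ m∉ ≤m) | yes x<y with to row⇔ m∈ | x <? m
  ... | m∈ys , m<y | yes x<m = trans
    (accept x<y m<y)
    (bump m∈ys m∉ x<m m<y)
  ... | m∈ys , m<y | no x≮m = begin
    length (freeAbove (m ∷ cs) x (y ∷ ys)) ≡⟨ accept x<y m<y ⟩
    suc (length (freeAbove (m ∷ cs) x ys)) ≡⟨ cong (suc ∘ length) (freeAbove-cloud-≮ ys x≮m) ⟩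
    -- `m` is the largest free letter below `y` and is at most `x`, so none lies strictly between
    -- `x` and `y`.
    suc (length (freeAbove cs x ys))       ≡⟨ no-bump x<y (λ c∈ c<y c∉ x<c → x≮m (<-≤-trans x<c (≤m (from row⇔ (c∈ , c<y)) c∉))) ⟩
    lisAbove x ys ⊔ suc (lisAbove y ys)    ∎

-- Rows of the snow diagram

snowCells : List Cell → List Cell
snowCells D = D ++ concatMap (snowflakes D) (darkClouds D)

∈-snow⁻ : ∀ {D r c} → (r , c) ∈ snowCells D →
          (r , c) ∈ D ⊎ ((r , c) ∉ D × ∃[ r′ ] (r < r′ × (r′ , c) ∈ darkClouds D))
∈-snow⁻ {D} p∈ with ∈-++⁻ D p∈
... | inj₁ p∈D = inj₁ p∈D
... | inj₂ p∈′ with find (∈-concatMap⁻ (snowflakes D) {xs = darkClouds D} p∈′)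
...   | (r′ , c) , q∈ , p∈s
        with ∈-filter⁻ (_∉ᶜ? D) {xs = map (λ k → suc k , c) (downFrom (r′ ∸ 1))} p∈s
...     | p∈m , p∉D with ∈-map⁻ (λ k → suc k , c) p∈m
...       | k , k∈ , refl = inj₂ (p∉D , r′ , <∸1⇒suc< r′ (∈-downFrom⁻ k∈) , q∈)
  where
  -- `r′ ∸ 1` truncates only at `r′ = 0`, where no `k` is listed.
  <∸1⇒suc< : ∀ {k} r′ → k < r′ ∸ 1 → suc k < r′
  <∸1⇒suc< (suc _) = s≤s

∈-snow⁺ : ∀ {D k r′ c} → (suc k , c) ∉ D → suc k < r′ → (r′ , c) ∈ darkClouds D →
          (suc k , c) ∈ snowCells D
∈-snow⁺ {D} {c = c} p∉D (s≤s k<r′) q∈ = ∈-++⁺ʳ D (∈-concatMap⁺ (snowflakes D)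
  (lose q∈ (∈-filter⁺ (_∉ᶜ? D) (∈-map⁺ (λ k → suc k , c) (∈-downFrom⁺ k<r′)) p∉D)))

Rothe-lastRow : ∀ {D k ys} → Rothe D k ys → ∀ {r c} → (r , c) ∈ D → r ≤ k + length ys
Rothe-lastRow {k = k} ([] D≤k) p∈ = ≤-trans (D≤k p∈) (m≤m+n k 0)
Rothe-lastRow {k = k} {y ∷ ys} (_ ∷ R) p∈ =
  ≤-trans (Rothe-lastRow R p∈) (≤-reflexive (sym (+-suc k (length ys))))

-- The columns of this row are the letters of `ys` that are not free above `y`: a smaller letter is
-- a cell of `D`, a larger one gets a snowflake exactly if its column has a cloud below.
rowSize-snow : ∀ {D} xs {y ys} → Rothe D 0 (xs ++ y ∷ ys) → Unique (y ∷ ys) →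
               rowSize (snowCells D) (suc (length xs)) ≡ length ys ∸ lisAbove y ys
rowSize-snow {D} xs {y} {ys} R₀ (y∉ ∷ ys!) with Rothe-++⁻ 0 xs R₀
... | row⇔ ∷ R = begin
  rowSize (snowCells D) (suc k)              ≡⟨ length-cong-⊆ (deduplicate-! _) coveredCells-! fwd bwd ⟩
  length (map cell covered)                  ≡⟨ length-map cell covered ⟩
  -- Adding and removing `length free` turns the count of a complement into a difference.
  length covered                             ≡⟨ m+n∸n≡m (length covered) (length free) ⟨
  length covered + length free ∸ length free ≡⟨ cong₂ _∸_ (length-filter-¬ free? ys) (length-freeAbove R ys! y) ⟩
  length ys ∸ lisAbove y ys                  ∎
  where
  open ≡-Reasoning
  k       = length xs
  cs      = cloudColumns D (suc k) ys
  free?   = freeAbove? cs y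
  free    = filter free? ys
  covered = filter (¬? ∘ free?) ys

  cell : ℕ → Cell
  cell c = suc k , c

  coveredCells-! : Unique (map cell covered)
  coveredCells-! = Unique.map⁺ (cong proj₂) (Unique.filter⁺ (¬? ∘ free?) ys!)

  |w|≡ : length (xs ++ y ∷ ys) ≡ suc k + length ys
  |w|≡ = trans (length-++ xs) (+-suc k (length ys))

  dark≡ : darkClouds D ≡ clouds D 0 (suc k + length ys)
  dark≡ = trans (darkClouds≡clouds D _ (Rothe-lastRow R₀)) (cong (clouds D 0) |w|≡)

  cover : ∀ {c} → (suc k , c) ∈ snowCells D → c ∈ ys × ¬ (y < c × c ∉ cs)
  cover p∈ with ∈-snow⁻ p∈
  ... | inj₁ p∈D = let c∈ , c<y = to row⇔ p∈D in c∈ , λ (y<c , _) → <-asym y<c c<y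
  ... | inj₂ (_ , r′ , k<r′ , q∈) =
    -- The cloud of the snowflake is below row `suc k`, so it was found before that row is reached,
    -- and `c` is not free.
    let c∈ = ∈-map⁺ proj₂ (clouds-all⁻ D (suc k) (length ys) (subst (_ ∈_) dark≡ q∈) k<r′)
    in cloudColumns-⊆ R c∈ , λ (_ , c∉) → c∉ c∈

  uncover : ∀ {c} → c ∈ ys → ¬ (y < c × c ∉ cs) → (suc k , c) ∈ snowCells D
  uncover {c} c∈ ¬free with <-cmp c y
  ... | tri< c<y _ _  = ∈-++⁺ˡ (from row⇔ (c∈ , c<y))
  ... | tri≈ _ refl _ = contradiction refl (All.lookup y∉ c∈)
  ... | tri> c≮y _ y<c with c ∈? cs
  ...   | no  c∉cs = contradiction (y<c , c∉cs) ¬free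
  ...   | yes c∈cs with ∈-map⁻ proj₂ c∈cs
  ...     | (r′ , _) , q∈ , refl = ∈-snow⁺ (λ p∈ → c≮y (proj₂ (to row⇔ p∈)))
              (proj₂ (∈-clouds⇒∈ D (suc k) (length ys) q∈))
              (subst (_ ∈_) (sym dark≡) (clouds-all⁺ D (suc k) (length ys) q∈))

  fwd : deduplicate _≟ᶜ_ (row (suc k) (snowCells D)) ⊆ map cell covered
  fwd p∈ with ∈-filter⁻ (λ (r′ , _) → r′ ≟ suc k) {xs = snowCells D} (∈-deduplicate⁻ _≟ᶜ_ (row (suc k) (snowCells D)) p∈)
  ... | p∈′ , refl = let c∈ , ¬free = cover p∈′ in ∈-map⁺ cell (∈-filter⁺ (¬? ∘ free?) c∈ ¬free)

  bwd : map cell covered ⊆ deduplicate _≟ᶜ_ (row (suc k) (snowCells D))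
  bwd p∈ with ∈-map⁻ cell p∈
  ... | c , c∈ , refl = let c∈ys , ¬free = ∈-filter⁻ (¬? ∘ free?) {xs = ys} c∈ in
    ∈-deduplicate⁺ _≟ᶜ_ (∈-filter⁺ (λ (r′ , _) → r′ ≟ suc k) (uncover c∈ys ¬free) refl)

-- A snowflake lies above a dark cloud, which is a cell of `D`; so no snowflake falls in a row after
-- `n`.
rowSize-snow-beyond : ∀ {D n r} → (∀ {r c} → (r , c) ∈ D → r ≤ n) → n < r →
                      rowSize (snowCells D) r ≡ 0
rowSize-snow-beyond {D} {n} {r} D≤n n<r =
  cong (length ∘ deduplicate _≟ᶜ_) (filter-none (λ (r′ , _) → r′ ≟ r) (All.tabulate beyond))
  where
  beyond : ∀ {p} → p ∈ snowCells D → proj₁ p ≢ r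
  beyond p∈ refl with ∈-snow⁻ p∈
  ... | inj₁ p∈D = <⇒≱ n<r (D≤n p∈D)
  ... | inj₂ (_ , r′ , r<r′ , q∈) = <⇒≱ (<-trans n<r r<r′) (D≤n (proj₁ (∈-clouds⇒∈ D 0 n
    (subst (_ ∈_) (darkClouds≡clouds D n D≤n) q∈))))

-- Rothe diagrams of permutations

-- The rows of `D` keep their numbers while `f` loses its first letter, so the offset `k` bridges
-- the two. The index pairs of inversions become membership in the remaining letters.
Rothe-tabulate : ∀ {D m} k (f : Fin m → ℕ) →
                 (∀ i {c} → (suc (k + toℕ i) , c) ∈ D ⇔ (∃[ j ] (i Fin.< j × c ≡ f j × f j < f i))) →
                 (∀ {r c} → (r , c) ∈ D → r ≤ k + m) →
                 Rothe D k (tabulate f)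
Rothe-tabulate {m = zero} k f _ D≤ = [] λ {r} p∈ → subst (r ≤_) (+-identityʳ k) (D≤ p∈)
Rothe-tabulate {D} {suc m} k f row⇔ D≤ =
  mk⇔ fwd bwd ∷
  Rothe-tabulate (suc k) (f ∘ Fin.suc) (λ i → mk⇔ (fwd′ i) (bwd′ i)) (λ {r} p∈ → subst (r ≤_) (+-suc k m) (D≤ p∈))
  where
  fwd : ∀ {c} → (suc k , c) ∈ D → c ∈ tabulate (f ∘ Fin.suc) × c < f Fin.zero
  fwd p∈ with to (row⇔ Fin.zero) (subst (λ r → (suc r , _) ∈ D) (sym (+-identityʳ k)) p∈)
  ... | Fin.suc j , _ , refl , fj<f0 = ∈-tabulate⁺ j , fj<f0
  bwd : ∀ {c} → c ∈ tabulate (f ∘ Fin.suc) × c < f Fin.zero → (suc k , c) ∈ D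
  bwd (c∈ , c<f0) with ∈-tabulate⁻ c∈
  ... | j , refl = subst (λ r → (suc r , _) ∈ D) (+-identityʳ k)
                     (from (row⇔ Fin.zero) (Fin.suc j , s≤s z≤n , refl , c<f0))
  fwd′ : ∀ i {c} → (suc (suc k + toℕ i) , c) ∈ D →
         ∃[ j ] (i Fin.< j × c ≡ f (Fin.suc j) × f (Fin.suc j) < f (Fin.suc i))
  fwd′ i {c} p∈ with to (row⇔ (Fin.suc i)) (subst (λ r → (suc r , c) ∈ D) (sym (+-suc k (toℕ i))) p∈)
  ... | Fin.suc j , s≤s i<j , eq , lt = j , i<j , eq , lt
  bwd′ : ∀ i {c} → ∃[ j ] (i Fin.< j × c ≡ f (Fin.suc j) × f (Fin.suc j) < f (Fin.suc i)) →
         (suc (suc k + toℕ i) , c) ∈ D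
  bwd′ i {c} (j , i<j , eq , lt) = subst (λ r → (suc r , c) ∈ D) (+-suc k (toℕ i))
    (from (row⇔ (Fin.suc i)) (Fin.suc j , s≤s i<j , eq , lt))

module _ {n} (w : Permutation′ n) where

  ∈-RD⁻ : ∀ {r c} → (r , c) ∈ cells (RD w) →
          ∃[ i ] ∃[ j ] (i Fin.< j × r ≡ position i × c ≡ value w j × value w j < value w i)
  ∈-RD⁻ p∈ with ∈-map⁻ (λ (r , r′) → position r , value w r′) p∈
  ... | (i , j) , ij∈ , refl
    with ∈-filter⁻ (λ (i , j) → (i Fin.<? j) ×-dec ((w ⟨$⟩ʳ j) Fin.<? (w ⟨$⟩ʳ i)))
                   {xs = cartesianProduct (allFin n) (allFin n)} ij∈
  ...   | _ , i<j , wj<wi = i , j , i<j , refl , refl , s≤s wj<wi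

  ∈-RD⁺ : ∀ {i j} → i Fin.< j → value w j < value w i → (position i , value w j) ∈ cells (RD w)
  ∈-RD⁺ {i} {j} i<j (s≤s wj<wi) = ∈-map⁺ (λ (r , r′) → position r , value w r′)
    (∈-filter⁺ _ (∈-cartesianProduct⁺ (∈-allFin i) (∈-allFin j)) (i<j , wj<wi))

  RD-lastRow : ∀ {r c} → (r , c) ∈ cells (RD w) → r ≤ n
  RD-lastRow p∈ with ∈-RD⁻ p∈
  ... | i , _ , _ , refl , _ = Fin.toℕ<n i

  Rothe-RD : Rothe (cells (RD w)) 0 (oneLine w)
  Rothe-RD = Rothe-tabulate 0 (value w) (λ i → mk⇔ (fwd i) λ { (j , i<j , refl , lt) → ∈-RD⁺ i<j lt }) RD-lastRow
    where
    fwd : ∀ i {c} → (position i , c) ∈ cells (RD w) → ∃[ j ] (i Fin.< j × c ≡ value w j × value w j < value w i)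
    fwd i p∈ with ∈-RD⁻ p∈
    ... | i′ , j , i′<j , eq , c≡ , lt with Fin.toℕ-injective (suc-injective eq)
    ...   | refl = j , i′<j , c≡ , lt

  oneLine-! : Unique (oneLine w)
  oneLine-! = Unique.tabulate⁺ λ eq → Injection.injective (↔⇒↣ w) (Fin.toℕ-injective (suc-injective eq))

tabulate-split : ∀ {m} (f : Fin m → ℕ) i →
                 ∃[ xs ] ∃[ ys ] (tabulate f ≡ xs ++ f i ∷ ys × length xs ≡ toℕ i)
tabulate-split f Fin.zero    = [] , _ , refl , refl
tabulate-split f (Fin.suc i) =
  let xs , ys , eq , len = tabulate-split (f ∘ Fin.suc) i
  in f Fin.zero ∷ xs , ys , cong (f Fin.zero ∷_) eq , cong suc len

Unique-++⁻ʳ : ∀ {a} {A : Set a} (xs : List A) {ys} → Unique (xs ++ ys) → Unique ys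
Unique-++⁻ʳ []       ys!       = ys!
Unique-++⁻ʳ (_ ∷ xs) (_ ∷ xs!) = Unique-++⁻ʳ xs xs!

-- `n + 1 ∸ position i` counts the letters from the one at `i` on, and `LIS` counts that letter too;
-- the two ones cancel.
rajcodeEntry≡rowSize : ∀ {n} (w : Permutation′ n) i →
                       n + 1 ∸ position i ∸ LIS w (value w i) ≡
                       rowSize (snowCells (cells (RD w))) (position i)
rajcodeEntry≡rowSize {n} w i with tabulate-split (value w) i
... | xs , ys , eq , |xs|≡i = begin
  n + 1 ∸ position i ∸ l                                ≡⟨ cong (_∸ l) suffix ⟩
  suc (length ys) ∸ l                                   ≡⟨ cong (suc (length ys) ∸_) (LIS≡1+lisAbove w xs eq (oneLine-! w)) ⟩
  length ys ∸ lisAbove (value w i) ys                   ≡⟨ rowSize-snow xs (subst (Rothe _ 0) eq (Rothe-RD w)) y∷ys! ⟨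
  rowSize (snowCells (cells (RD w))) (suc (length xs))  ≡⟨ cong (rowSize (snowCells (cells (RD w))) ∘ suc) |xs|≡i ⟩
  rowSize (snowCells (cells (RD w))) (position i)       ∎
  where
  open ≡-Reasoning
  l = LIS w (value w i)

  n≡ : n ≡ toℕ i + suc (length ys)
  n≡ = begin
    n                           ≡⟨ length-tabulate (value w) ⟨
    length (oneLine w)          ≡⟨ cong length eq ⟩
    length (xs ++ _ ∷ ys)       ≡⟨ length-++ xs ⟩
    length xs + suc (length ys) ≡⟨ cong (_+ suc (length ys)) |xs|≡i ⟩
    toℕ i + suc (length ys)     ∎

  suffix : n + 1 ∸ position i ≡ suc (length ys)
  suffix = begin
    -- Once `n + 1` is commuted to `suc n`, the two successors cancel by computation.
    n + 1 ∸ position i              ≡⟨ cong (_∸ position i) (+-comm n 1) ⟩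
    n ∸ toℕ i                       ≡⟨ cong (_∸ toℕ i) n≡ ⟩
    toℕ i + suc (length ys) ∸ toℕ i ≡⟨ m+n∸m≡n (toℕ i) (suc (length ys)) ⟩
    suc (length ys)                 ∎

  y∷ys! : Unique (value w i ∷ ys)
  y∷ys! = Unique-++⁻ʳ xs (subst Unique eq (oneLine-! w))

theorem5p5 : (n : ℕ) (w : Permutation′ n) → rajcodeᴾ w ≈ rajcodeᴰ (RD w)
theorem5p5 n w (suc k) with k <? n
... | no  k≮n = sym (rowSize-snow-beyond (RD-lastRow w) (s≤s (≮⇒≥ k≮n)))
-- Only the row number is generalised; the value keeps the index `i` used by `rajcodeEntry`.
... | yes k<n = subst
  (λ r → n + 1 ∸ suc r ∸ LIS w (value w i) ≡ rowSize (snowCells (cells (RD w))) (suc r))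
  (Fin.toℕ-fromℕ< k<n) (rajcodeEntry≡rowSize w i)
  where i = fromℕ< k<n
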